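{- Let $\gamma$ be a long-term temporal goal assignment of type $\mathsf U$ (i.e. $\gamma$ maps every coalition in its support to a $\mathsf U$-formula or a $\mathsf G$-formula, and at least one of them to a $\mathsf U$-formula), and let $z$ be a fresh variable not occurring in $\langle\![\gamma]\!\rangle$. Then $\langle\![\gamma]\!\rangle\equiv\mu z.\,\mathsf{ind}(\gamma,z)$, i.e. the two formulas are true at exactly the same states of every concurrent game model.
   Context: **Models.** Fix a finite set $\mathsf{Agt}$ of agents and a set $\mathsf{AP}$ of atomic propositions; a coalition is any subset of $\mathsf{Agt}$. A game form over an outcome set $O$ is $(\mathsf{Act},\mathsf{act},O,\mathsf{out})$ with $\mathsf{Act}\ne\emptyset$, $\mathsf{act}$ assigning to each agent $a$ a non-empty set $\mathsf{act}_a\subseteq\mathsf{Act}$, and $\mathsf{out}:\prod_{a\in\mathsf{Agt}}\mathsf{act}_a\to O$. A concurrent game model is $\mathcal M=(S,\mathsf{Act},\mathfrak g,V)$ with $S\neq\emptyset$ a set of states, $\mathfrak g$ assigning to each $w\in S$ a game form $(\mathsf{Act},\mathsf{act}_w,S,\mathsf{out}_w)$ over $S$, and $V:\mathsf{AP}\to\mathcal P(S)$. A history is a finite word $w_0\zeta_0w_1\cdots\zeta_{n-1}w_n$ ($n\ge 0$) with $w_i\in S$ and $\zeta_i\in\prod_a\mathsf{act}_{w_i}(a)$. A strategy for $a$ maps each history ending in $w$ to an element of $\mathsf{act}_w(a)$; a strategy profile $\Sigma$ assigns a strategy to each agent. The play induced by $\Sigma$ at $w$ is $w_0\zeta_0w_1\zeta_1\cdots$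 with $w_0=w$, $\zeta_n=\Sigma(w_0\zeta_0\cdots w_n)$, $w_{n+1}=\mathsf{out}_{w_n}(\zeta_n)$; its path is $w_0w_1w_2\cdots$. $\mathsf{paths}(w,\Sigma,C)$ is the set of paths of plays induced at $w$ by strategy profiles $\Sigma'$ that agree with $\Sigma$ on all agents in $C$. **Language.** State formulas: $\varphi::=p\mid\top\mid\neg\varphi\mid(\varphi\wedge\varphi)\mid(\varphi\vee\varphi)\mid\langle\![\gamma]\!\rangle$; path formulas: $\theta::=\mathsf X\varphi\mid\varphi\,\mathsf U\,\varphi\mid\mathsf G\varphi$; here $p\in\mathsf{AP}$ and $\gamma$ is a goal assignment, i.e. a map from $\mathcal P(\mathsf{Agt})$ to path formulas. $\mathsf X\top$ is the trivial goal; the support of $\gamma$ is the set of coalitions $C$ with $\gamma(C)\neq\mathsf X\top$. If $\gamma$ has empty support, $\langle\![\gamma]\!\rangle$ is identified with $\top$. This language ($\mathsf{TLCGA}$) is extended with state formulas $\mu x.\varphi$, where $x$ is a propositional variable all of whose occurrences in $\varphi$ are positive (under an even number of negations). In the statement $\gamma$ is a goal assignment of $\mathsf{TLCGA}$. **Semantics.** Booleans as usual. For a path $\pi=w_0w_1\cdots$: $\pi\Vdash\mathsf X\varphi$ iff $\varphi$ is true at $w_1$; $\pi\Vdash\varphi\,\mathsf U\,\psi$ iff for some $i$, $\psi$ is true at $w_i$ and $\varphi$ at all $w_j$, $j<i$; $\pi\Vdash\mathsf G\varphi$ iff $\varphi$ is true at all $w_i$. $\mathcal M,s\Vdash\langle\![\gamma]\!\rangle$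 iff there is a strategy profile $\Sigma$ such that for every $C\subseteq\mathsf{Agt}$ and every $\pi\in\mathsf{paths}(s,\Sigma,C)$, $\pi\Vdash\gamma(C)$. The extension of $\mu z.\varphi(z)$ in $\mathcal M$ is $\bigcap\{Z\subseteq S\mid [\![\varphi(Z)]\!]\subseteq Z\}$, where $[\![\varphi(Z)]\!]$ is the set of states satisfying $\varphi$ when the valuation is changed to map $z$ to $Z$. **Notation on goal assignments.** $\gamma[C\triangleright\theta]$ is $\gamma$ modified to map $C$ to $\theta$; $\gamma\setminus C:=\gamma[C\triangleright\mathsf X\top]$; $\gamma|_C$ maps each $C'\subseteq C$ to $\gamma(C')$ and all other coalitions to $\mathsf X\top$. **Induction formula.** Let $\gamma$ be long-term temporal with support $\mathcal F$. The nexttime-extension $\Delta\gamma$ has support $\{\bigcup\mathcal F'\mid\emptyset\ne\mathcal F'\subseteq\mathcal F\}$; for $C$ in that set $\Delta\gamma(C):=\mathsf X\langle\![\gamma|_C]\!\rangle$, other coalitions getting the trivial goal. Put $\Delta\gamma\{\phi\}:=\Delta\gamma[\bigcup\mathcal F\triangleright\mathsf X\phi]$. Let $\mathsf{Finish}(\gamma)=\{\beta\wedge\langle\![\gamma\setminus C]\!\rangle\mid\gamma(C)=\alpha\,\mathsf U\,\beta\}$, $\mathsf{UHolds}(\gamma)=\{\alpha\mid\gamma(C)=\alpha\,\mathsf U\,\beta\text{ for some }C,\beta\}$, $\mathsf{GHolds}(\gamma)=\{\chi\mid\gamma(C)=\mathsf G\chi\text{ for some }C\}$. Then $$\mathsf{ind}(\gamma,\phi):=\bigvee\mathsf{Finish}(\gamma)\vee\Big(\bigwedge\mathsf{UHolds}(\gamma)\wedge\bigwedge\mathsf{GHolds}(\gamma)\wedge\langle\![\Delta\gamma\{\phi\}]\!\rangle\Big),$$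 with empty conjunctions ($\top$) and empty disjunctions ($\bot$) removed where redundant. -}

module Defs where

open import Axiom.ExcludedMiddle public using (ExcludedMiddle)

open import Data.Bool.Base using (Bool; true; false; if_then_else_; T)
open import Data.Bool.Properties using () renaming (_≟_ to _≟ᵇ_)
open import Data.Empty using (⊥)
open import Data.Fin.Base using (Fin)
open import Data.Fin.Subset using (Subset; inside; outside; ⋃; _∈_)
open import Data.Fin.Subset.Properties using (anySubset?; _⊆?_)
open import Data.List.Base
  using (List; []; _∷_; [_]; _++_; _∷ʳ_; map; concatMap; filter)
import Data.List.Membership.DecPropositional as DecMembership
open import Data.List.Relation.Unary.All as All using (All; []; _∷_)
open import Data.List.Relation.Unary.All.Properties as All using ()
open import Data.Nat.Base using (ℕ; zero; suc; _<_)
open import Data.Nat.Properties using () renaming (_≟_ to _≟ⁿ_)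
open import Data.Parity.Base using (Parity; 0ℙ; _⁻¹)
open import Data.Product.Base using (Σ-syntax; ∃; ∃₂; _×_; _,_; proj₁; proj₂)
open import Data.Refinement.Base using (Refinement)
open import Data.Sum.Base using (_⊎_)
open import Data.Unit.Base using (⊤; tt)
open import Data.Vec.Base using ([]; _∷_)
open import Data.Vec.Properties using (≡-dec)
open import Function.Base using (_∘_)
open import Function.Bundles using (_⇔_)
open import Level using (Level; Lift; _⊔_) renaming (suc to lsuc)
open import Relation.Binary.Definitions using (DecidableEquality)
open import Relation.Binary.PropositionalEquality.Core using (_≡_; _≢_; refl)
open import Relation.Nullary.Decidable.Core
  using (Dec; yes; no; does; ¬?; decidable-stable; map′)
open import Relation.Nullary.Negation.Core using (¬_; contradiction)
open import Relation.Unary using (Pred; Satisfiable)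

private
  variable
    a ℓ : Level
    n   : ℕ
    AP  : Set a

-- The set of agents is Fin n.
Coalition : ℕ → Set
Coalition = Subset

Var : Set
Var = ℕ

infix  9 ¬′_ X_ G_
infix  8 _U_
infixr 7 _∧′_
infixr 6 _∨′_

mutual
  data StateFormula (AP : Set a) (n : ℕ) : Set a where
    atom      : AP → StateFormula AP n
    var       : Var → StateFormula AP n
    ⊤′        : StateFormula AP n
    ¬′_       : StateFormula AP n → StateFormula AP n
    _∧′_ _∨′_ : StateFormula AP n → StateFormula AP n → StateFormula AP n
    ⟪_⟫       : (Coalition n → PathFormula AP n) → StateFormula AP n
    μ         : (x : Var) (φ : StateFormula AP n) → Positive x φ →
                StateFormula AP n

  data PathFormula (AP : Set a) (n : ℕ) : Set a where
    X_ G_ : StateFormula AP n → PathFormula AP n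
    _U_   : StateFormula AP n → StateFormula AP n → PathFormula AP n

  -- EvenOcc p x φ: every free occurrence of x in φ is under a number of
  -- negations which, added to p, is even.
  EvenOcc : {AP : Set a} {n : ℕ} → Parity → Var → StateFormula AP n → Set
  EvenOcc p x (atom q)  = ⊤
  EvenOcc p x (var y)   = x ≡ y → p ≡ 0ℙ
  EvenOcc p x ⊤′        = ⊤
  EvenOcc p x (¬′ φ)    = EvenOcc (p ⁻¹) x φ
  EvenOcc p x (φ ∧′ ψ)  = EvenOcc p x φ × EvenOcc p x ψ
  EvenOcc p x (φ ∨′ ψ)  = EvenOcc p x φ × EvenOcc p x ψ
  EvenOcc p x ⟪ γ ⟫     = ∀ C → EvenOccᵖ p x (γ C)
  EvenOcc p x (μ y φ _) = x ≢ y → EvenOcc p x φ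

  EvenOccᵖ : {AP : Set a} {n : ℕ} → Parity → Var → PathFormula AP n → Set
  EvenOccᵖ p x (X φ)   = EvenOcc p x φ
  EvenOccᵖ p x (G φ)   = EvenOcc p x φ
  EvenOccᵖ p x (φ U ψ) = EvenOcc p x φ × EvenOcc p x ψ

  Positive : {AP : Set a} {n : ℕ} → Var → StateFormula AP n → Set
  Positive = EvenOcc 0ℙ

GoalAssignment : Set a → ℕ → Set a
GoalAssignment AP n = Coalition n → PathFormula AP n

mutual
  Fresh : Var → StateFormula AP n → Set
  Fresh x (atom q)  = ⊤
  Fresh x (var y)   = x ≢ y
  Fresh x ⊤′        = ⊤
  Fresh x (¬′ φ)    = Fresh x φ
  Fresh x (φ ∧′ ψ)  = Fresh x φ × Fresh x ψ
  Fresh x (φ ∨′ ψ)  = Fresh x φ × Fresh x ψ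
  Fresh x ⟪ γ ⟫     = ∀ C → Freshᵖ x (γ C)
  Fresh x (μ y φ _) = x ≢ y × Fresh x φ

  Freshᵖ : Var → PathFormula AP n → Set
  Freshᵖ x (X φ)   = Fresh x φ
  Freshᵖ x (G φ)   = Fresh x φ
  Freshᵖ x (φ U ψ) = Fresh x φ × Fresh x ψ

-- Membership in the fixpoint-free language TLCGA. Propositional variables
-- may occur free; there they behave as further atomic propositions.
mutual
  IsTLCGA : StateFormula AP n → Set
  IsTLCGA (atom q)  = ⊤
  IsTLCGA (var y)   = ⊤
  IsTLCGA ⊤′        = ⊤
  IsTLCGA (¬′ φ)    = IsTLCGA φ
  IsTLCGA (φ ∧′ ψ)  = IsTLCGA φ × IsTLCGA ψ
  IsTLCGA (φ ∨′ ψ)  = IsTLCGA φ × IsTLCGA ψ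
  IsTLCGA ⟪ γ ⟫     = ∀ C → IsTLCGAᵖ (γ C)
  IsTLCGA (μ y φ _) = ⊥

  IsTLCGAᵖ : PathFormula AP n → Set
  IsTLCGAᵖ (X φ)   = IsTLCGA φ
  IsTLCGAᵖ (G φ)   = IsTLCGA φ
  IsTLCGAᵖ (φ U ψ) = IsTLCGA φ × IsTLCGA ψ

-- Since ⟪ γ ⟫ is identified with ⊤′ when γ has empty support, being the
-- trivial goal X ⊤′ is understood modulo this identification.
mutual
  Trivial : PathFormula AP n → Set
  Trivial (X φ)   = IsTop φ
  Trivial (G φ)   = ⊥
  Trivial (φ U ψ) = ⊥

  IsTop : StateFormula AP n → Set
  IsTop ⊤′        = ⊤
  IsTop ⟪ γ ⟫     = ∀ C → Trivial (γ C)
  IsTop (atom _)  = ⊥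
  IsTop (var _)   = ⊥
  IsTop (¬′ _)    = ⊥
  IsTop (_ ∧′ _)  = ⊥
  IsTop (_ ∨′ _)  = ⊥
  IsTop (μ _ _ _) = ⊥

allSubset? : ∀ {p} {P : Pred (Subset n) p} →
             (∀ C → Dec (P C)) → Dec (∀ C → P C)
allSubset? P? = map′
  (λ ¬∃¬ C → decidable-stable (P? C) (λ ¬p → ¬∃¬ (C , ¬p)))
  (λ ∀P (C , ¬p) → ¬p (∀P C))
  (¬? (anySubset? (λ C → ¬? (P? C))))

mutual
  trivial? : (θ : PathFormula AP n) → Dec (Trivial θ)
  trivial? (X φ)   = isTop? φ
  trivial? (G φ)   = no λ ()
  trivial? (φ U ψ) = no λ ()

  isTop? : (φ : StateFormula AP n) → Dec (IsTop φ)
  isTop? ⊤′        = yes tt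
  isTop? ⟪ γ ⟫     = allSubset? (λ C → trivial? (γ C))
  isTop? (atom _)  = no λ ()
  isTop? (var _)   = no λ ()
  isTop? (¬′ _)    = no λ ()
  isTop? (_ ∧′ _)  = no λ ()
  isTop? (_ ∨′ _)  = no λ ()
  isTop? (μ _ _ _) = no λ ()

_∈supp_ : Coalition n → GoalAssignment AP n → Set
C ∈supp γ = ¬ Trivial (γ C)

IsU IsG : {AP : Set a} → PathFormula AP n → Set a
IsU θ = ∃₂ λ α β → θ ≡ α U β
IsG θ = ∃  λ χ   → θ ≡ G χ

LongTermTemporal : {AP : Set a} → GoalAssignment AP n → Set a
LongTermTemporal γ = ∀ C → C ∈supp γ → IsU (γ C) ⊎ IsG (γ C)

OfTypeU : {AP : Set a} → GoalAssignment AP n → Set a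
OfTypeU γ = ∃ λ C → IsU (γ C)

_≟ᶜ_ : DecidableEquality (Coalition n)
_≟ᶜ_ = ≡-dec _≟ᵇ_

infixl 10 _[_▷_] _∖_ _∣_

_[_▷_] : GoalAssignment AP n → Coalition n → PathFormula AP n →
         GoalAssignment AP n
(γ [ C ▷ θ ]) D = if does (D ≟ᶜ C) then θ else γ D

_∖_ : GoalAssignment AP n → Coalition n → GoalAssignment AP n
γ ∖ C = γ [ C ▷ X ⊤′ ]

_∣_ : GoalAssignment AP n → Coalition n → GoalAssignment AP n
(γ ∣ C) D = if does (D ⊆? C) then γ D else X ⊤′

coalitions : ∀ n → List (Coalition n)
coalitions zero    = [ [] ]
coalitions (suc n) =
  map (inside ∷_) (coalitions n) ++ map (outside ∷_) (coalitions n)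

nonemptySublists : ∀ {b} {B : Set b} → List B → List (List B)
nonemptySublists []       = []
nonemptySublists (x ∷ xs) =
  [ x ] ∷ map (x ∷_) (nonemptySublists xs) ++ nonemptySublists xs

support : GoalAssignment AP n → List (Coalition n)
support {n = n} γ = filter (λ C → ¬? (trivial? (γ C))) (coalitions n)

unions : GoalAssignment AP n → List (Coalition n)
unions γ = map ⋃ (nonemptySublists (support γ))

Δ : GoalAssignment AP n → GoalAssignment AP n
Δ γ C = if does (C ∈? unions γ) then X ⟪ γ ∣ C ⟫ else X ⊤′
  where open DecMembership _≟ᶜ_ using (_∈?_)

Δ_⟨_⟩ : GoalAssignment AP n → StateFormula AP n → GoalAssignment AP n
Δ γ ⟨ φ ⟩ = Δ γ [ ⋃ (support γ) ▷ X φ ]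

⋀ ⋁ : List (StateFormula AP n) → StateFormula AP n
⋀ []           = ⊤′
⋀ (φ ∷ [])     = φ
⋀ (φ ∷ ψ ∷ φs) = φ ∧′ ⋀ (ψ ∷ φs)
⋁ []           = ¬′ ⊤′
⋁ (φ ∷ [])     = φ
⋁ (φ ∷ ψ ∷ φs) = φ ∨′ ⋁ (ψ ∷ φs)

finishOf : GoalAssignment AP n → Coalition n → PathFormula AP n →
           List (StateFormula AP n)
finishOf γ C (α U β) = [ β ∧′ ⟪ γ ∖ C ⟫ ]
finishOf γ C (X _)   = []
finishOf γ C (G _)   = []

uHoldsOf gHoldsOf : PathFormula AP n → List (StateFormula AP n)
uHoldsOf (α U β) = [ α ]
uHoldsOf (X _)   = []
uHoldsOf (G _)   = []
gHoldsOf (G χ)   = [ χ ]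
gHoldsOf (X _)   = []
gHoldsOf (_ U _) = []

Finish UHolds GHolds : GoalAssignment AP n → List (StateFormula AP n)
Finish {n = n} γ = concatMap (λ C → finishOf γ C (γ C)) (coalitions n)
UHolds {n = n} γ = concatMap (uHoldsOf ∘ γ) (coalitions n)
GHolds {n = n} γ = concatMap (gHoldsOf ∘ γ) (coalitions n)

-- Concatenating the lists, rather than joining ⋁ (Finish γ), ⋀ (UHolds γ)
-- and ⋀ (GHolds γ) by connectives, drops the redundant empty disjunctions
-- and conjunctions.
ind : GoalAssignment AP n → StateFormula AP n → StateFormula AP n
ind γ φ =
  ⋁ (Finish γ ∷ʳ ⋀ (UHolds γ ++ GHolds γ ++ [ ⟪ Δ γ ⟨ φ ⟩ ⟫ ]))

mutual
  fresh⇒even : ∀ p z (φ : StateFormula AP n) → Fresh z φ → EvenOcc p z φ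
  fresh⇒even p z (atom q)  f       = tt
  fresh⇒even p z (var y)   z≢y     = λ z≡y → contradiction z≡y z≢y
  fresh⇒even p z ⊤′        f       = tt
  fresh⇒even p z (¬′ φ)    f       = fresh⇒even (p ⁻¹) z φ f
  fresh⇒even p z (φ ∧′ ψ)  (f , g) = fresh⇒even p z φ f , fresh⇒even p z ψ g
  fresh⇒even p z (φ ∨′ ψ)  (f , g) = fresh⇒even p z φ f , fresh⇒even p z ψ g
  fresh⇒even p z ⟪ γ ⟫     f       = λ C → fresh⇒evenᵖ p z (γ C) (f C)
  fresh⇒even p z (μ y φ _) (_ , f) = λ _ → fresh⇒even p z φ f

  fresh⇒evenᵖ : ∀ p z (θ : PathFormula AP n) → Freshᵖ z θ → EvenOccᵖ p z θ
  fresh⇒evenᵖ p z (X φ)   f       = fresh⇒even p z φ f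
  fresh⇒evenᵖ p z (G φ)   f       = fresh⇒even p z φ f
  fresh⇒evenᵖ p z (φ U ψ) (f , g) = fresh⇒even p z φ f , fresh⇒even p z ψ g

module _ {AP : Set a} {n : ℕ} (γ : GoalAssignment AP n) (z : Var)
         (fresh : Fresh z ⟪ γ ⟫) where

  private
    Pos : StateFormula AP n → Set
    Pos = Positive z

    Posᵖ : PathFormula AP n → Set
    Posᵖ = EvenOccᵖ 0ℙ z

    ⋀-pos : ∀ {φs} → All Pos φs → Pos (⋀ φs)
    ⋀-pos []           = tt
    ⋀-pos (p ∷ [])     = p
    ⋀-pos (p ∷ q ∷ ps) = p , ⋀-pos (q ∷ ps)

    ⋁-pos : ∀ {φs} → All Pos φs → Pos (⋁ φs)
    ⋁-pos []           = tt
    ⋁-pos (p ∷ [])     = p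
    ⋁-pos (p ∷ q ∷ ps) = p , ⋁-pos (q ∷ ps)

    if-pos : ∀ b {θ θ′} → Posᵖ θ → Posᵖ θ′ → Posᵖ (if b then θ else θ′)
    if-pos true       p q = p
    if-pos false p q = q

    γ-pos : ∀ C → Posᵖ (γ C)
    γ-pos C = fresh⇒evenᵖ 0ℙ z (γ C) (fresh C)

    concatMap-pos : (f : Coalition n → List (StateFormula AP n)) →
                    (∀ C → All Pos (f C)) →
                    All Pos (concatMap f (coalitions n))
    concatMap-pos f ps = All.concat⁺ (All.map⁺ (All.universal ps (coalitions n)))

    finishOf-pos : ∀ C θ → Posᵖ θ → All Pos (finishOf γ C θ)
    finishOf-pos C (α U β) (_ , p) =
      (p , λ D → if-pos (does (D ≟ᶜ C)) tt (γ-pos D)) ∷ []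
    finishOf-pos C (X _) _ = []
    finishOf-pos C (G _) _ = []

    uHoldsOf-pos : ∀ θ → Posᵖ θ → All Pos (uHoldsOf θ)
    uHoldsOf-pos (α U β) (p , _) = p ∷ []
    uHoldsOf-pos (X _)   _       = []
    uHoldsOf-pos (G _)   _       = []

    gHoldsOf-pos : ∀ θ → Posᵖ θ → All Pos (gHoldsOf θ)
    gHoldsOf-pos (G χ)   p = p ∷ []
    gHoldsOf-pos (X _)   _ = []
    gHoldsOf-pos (_ U _) _ = []

    Δ-pos : ∀ C → Posᵖ (Δ γ ⟨ var z ⟩ C)
    Δ-pos C = if-pos (does (C ≟ᶜ ⋃ (support γ))) (λ _ → refl)
      (if-pos (does (C ∈? unions γ))
        (λ D → if-pos (does (D ⊆? C)) (γ-pos D) tt) tt)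
      where open DecMembership _≟ᶜ_ using (_∈?_)

  ind-positive : Positive z (ind γ (var z))
  ind-positive = ⋁-pos (All.++⁺
    (concatMap-pos _ (λ C → finishOf-pos C (γ C) (γ-pos C)))
    (⋀-pos (All.++⁺
      (concatMap-pos _ (λ C → uHoldsOf-pos (γ C) (γ-pos C)))
      (All.++⁺
        (concatMap-pos _ (λ C → gHoldsOf-pos (γ C) (γ-pos C)))
        (Δ-pos ∷ []))) ∷ []))

record GameForm (n : ℕ) (Act O : Set ℓ) : Set (lsuc ℓ) where
  field
    act          : Fin n → Pred Act ℓ
    act-nonempty : ∀ i → Satisfiable (act i)

  ActionProfile : Set ℓ
  ActionProfile = ∀ i → Refinement Act (act i)

  field
    out : ActionProfile → O

record ConcurrentGameModel (n : ℕ) (AP : Set a) (ℓ : Level) :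
                           Set (a ⊔ lsuc ℓ) where
  field
    State          : Set ℓ
    Act            : Set ℓ
    state-nonempty : State
    act-nonempty   : Act
    gameForm       : State → GameForm n Act State
    valuation      : AP → Pred State ℓ

  Action : State → Fin n → Set ℓ
  Action w i = Refinement Act (GameForm.act (gameForm w) i)

  Profile : State → Set ℓ
  Profile w = GameForm.ActionProfile (gameForm w)

  out : ∀ w → Profile w → State
  out w = GameForm.out (gameForm w)

  -- Histories are indexed by their last state. They are arbitrary words,
  -- whose consecutive states need not be related by the outcome functions.
  data History : State → Set ℓ where
    start : ∀ w → History w
    _▸_▸_ : ∀ {w} → History w → Profile w → ∀ w′ → History w′

  Strategy : Fin n → Set ℓ
  Strategy i = ∀ {w} → History w → Action w i

  StrategyProfile : Set ℓ
  StrategyProfile = ∀ i → Strategy i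

  choice : StrategyProfile → ∀ {w} → History w → Profile w
  choice σ h i = σ i h

  -- The finite prefixes of the induced play, each with its last state.
  play : State → StrategyProfile → ℕ → ∃ History
  play w σ zero    = w , start w
  play w σ (suc k) = let (v , h) = play w σ k
                         v′      = out v (choice σ h)
                     in v′ , (h ▸ choice σ h ▸ v′)

  path : State → StrategyProfile → ℕ → State
  path w σ k = proj₁ (play w σ k)

  AgreeOn : Coalition n → StrategyProfile → StrategyProfile → Set ℓ
  AgreeOn C σ σ′ = ∀ i → i ∈ C → ∀ {w} (h : History w) → σ′ i h ≡ σ i h

  paths : State → StrategyProfile → Coalition n → Pred (ℕ → State) ℓ
  paths w σ C π = Σ[ σ′ ∈ StrategyProfile ]
    AgreeOn C σ σ′ × (∀ k → π k ≡ path w σ′ k)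

module Semantics {AP : Set a} {n : ℕ}
                 (M : ConcurrentGameModel n AP ℓ) where

  open ConcurrentGameModel M

  -- Subsets of S assigned to variables are given by characteristic
  -- functions. Under excluded middle these are all the subsets, and the
  -- quantification over them in the clause for μ stays in Set ℓ, so that
  -- fixpoints can be nested.
  Assignment : Set ℓ
  Assignment = Var → State → Bool

  _[_↦_] : Assignment → Var → (State → Bool) → Assignment
  (ρ [ x ↦ Z ]) y = if does (y ≟ⁿ x) then Z else ρ y

  mutual
    _,_⊨_ : Assignment → State → StateFormula AP n → Set ℓ
    ρ , s ⊨ atom p    = valuation p s
    ρ , s ⊨ var x     = Lift ℓ (T (ρ x s))
    ρ , s ⊨ ⊤′        = Lift ℓ ⊤
    ρ , s ⊨ (¬′ φ)    = ¬ (ρ , s ⊨ φ)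
    ρ , s ⊨ (φ ∧′ ψ)  = (ρ , s ⊨ φ) × (ρ , s ⊨ ψ)
    ρ , s ⊨ (φ ∨′ ψ)  = (ρ , s ⊨ φ) ⊎ (ρ , s ⊨ ψ)
    ρ , s ⊨ ⟪ γ ⟫     = Σ[ σ ∈ StrategyProfile ]
                          (∀ C π → paths s σ C π → ρ , π ⊩ γ C)
    ρ , s ⊨ (μ x φ _) = ∀ (Z : State → Bool) →
                          (∀ t → ((ρ [ x ↦ Z ]) , t ⊨ φ) → T (Z t)) → T (Z s)

    _,_⊩_ : Assignment → (ℕ → State) → PathFormula AP n → Set ℓ
    ρ , π ⊩ (X φ)   = ρ , π 1 ⊨ φ
    ρ , π ⊩ (G φ)   = ∀ i → ρ , π i ⊨ φ
    ρ , π ⊩ (φ U ψ) = Σ[ i ∈ ℕ ]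
      (ρ , π i ⊨ ψ) × (∀ j → j < i → ρ , π j ⊨ φ)

Equivalent : ∀ {a} {AP : Set a} {n} ℓ →
             StateFormula AP n → StateFormula AP n → Set (a ⊔ lsuc ℓ)
Equivalent {AP = AP} {n} ℓ φ ψ = (M : ConcurrentGameModel n AP ℓ) →
  let open Semantics M in
  ∀ ρ s → (ρ , s ⊨ φ) ⇔ (ρ , s ⊨ ψ)

{-# OPTIONS --safe #-}

-- Let W be the extension of ⟪ γ ⟫.
-- W is a pre-fixpoint: given a profile σ for the nexttime-extension at s, play
-- σ for one step, look which agents followed it, let C be the union of all
-- supported coalitions among them, and continue with a witness of ⟪ γ ∣ C ⟫.
-- W is below every pre-fixpoint Z: if σ witnesses ⟪ γ ⟫ at s ∉ Z, then the
-- agents outside the union of the support can keep the play outside Z, with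
-- ⟪ γ ⟫ still true at every state of it. On that play no goal α U β can reach
-- β, for then Finish γ would put the state into Z.
module Submission where

open import Defs
open import Level using (Level; Lift; lift)
open import Data.Bool.Base using (Bool; true; false; if_then_else_; T)
open import Data.Empty using (⊥)
open import Data.Fin.Subset using (Subset; inside; outside; ⋃; _∈_; _⊆_)
open import Data.Fin.Subset.Properties
  using (_⊆?_; ∉⊥; ⊆-trans; p⊆p∪q; q⊆p∪q; x∈p∪q⁻)
open import Data.List.Base
  using (List; []; _∷_; [_]; _++_; _∷ʳ_; concatMap; filter)
import Data.List.Membership.DecPropositional as DecMembership
open import Data.List.Membership.Propositional using (find; lose)
  renaming (_∈_ to _∈ˡ_)
open import Data.List.Membership.Propositional.Properties
  using (∈-filter⁺; ∈-map⁺; ∈-++⁺ˡ; ∈-++⁺ʳ)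
open import Data.List.Relation.Unary.All as All using (All; []; _∷_)
import Data.List.Relation.Unary.All.Properties as All
open import Data.List.Relation.Unary.Any as Any using (Any; here; there)
import Data.List.Relation.Unary.Any.Properties as Any
open import Data.Nat.Base using (ℕ; zero; suc; z<s; s<s; s<s⁻¹)
open import Data.Nat.Properties using () renaming (_≟_ to _≟ⁿ_)
open import Data.Product.Base using (Σ-syntax; ∃; _×_; _,_; proj₁; proj₂)
open import Data.Refinement.Base using (_,_)
open import Data.Irrelevant using () renaming ([_] to [_]ⁱ)
open import Data.Sum.Base as Sum using (_⊎_; inj₁; inj₂)
open import Data.Unit.Base using (tt)
open import Data.Vec.Base using ([]; _∷_; tabulate)
open import Data.Vec.Properties using (lookup∘tabulate; lookup⇒[]=; []=⇒lookup)
open import Function.Base using (_∘_; id)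
open import Function.Bundles using (mk⇔)
open import Relation.Binary.PropositionalEquality
  using (_≡_; _≢_; refl; sym; trans; cong; subst)
open import Relation.Nullary.Decidable.Core
  using (Dec; yes; no; does; ¬?; decidable-stable; ⌊_⌋; toWitness; fromWitness)
open import Relation.Nullary.Decidable using (dec-true; dec-false)
open import Relation.Nullary.Negation.Core using (¬_; contradiction)
open import Relation.Unary using (Pred; Decidable)

private
  variable
    a b p : Level
    n     : ℕ
    AP    : Set a

-- Unions of supported coalitions.

∈-coalitions : (C : Coalition n) → C ∈ˡ coalitions n
∈-coalitions []            = here refl
∈-coalitions (inside  ∷ C) = ∈-++⁺ˡ (∈-map⁺ _ (∈-coalitions C))
∈-coalitions (outside ∷ C) = ∈-++⁺ʳ _ (∈-map⁺ _ (∈-coalitions C))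

⊆-⋃ : ∀ {Cs : List (Subset n)} {C} → C ∈ˡ Cs → C ⊆ ⋃ Cs
⊆-⋃ {Cs = C ∷ Cs} (here refl) = p⊆p∪q (⋃ Cs)
⊆-⋃ {Cs = D ∷ Cs} (there C∈)  = ⊆-trans (⊆-⋃ C∈) (q⊆p∪q D (⋃ Cs))

⋃-⊆ : ∀ {Cs : List (Subset n)} {D} → All (_⊆ D) Cs → ⋃ Cs ⊆ D
⋃-⊆ []           i∈ = contradiction i∈ ∉⊥
⋃-⊆ {Cs = C ∷ Cs} (C⊆ ∷ Cs⊆) i∈ = Sum.[ C⊆ , ⋃-⊆ Cs⊆ ]′ (x∈p∪q⁻ C (⋃ Cs) i∈)

-- `unions` ranges over the nonempty sublists of the support, so a union over a filtered support is
-- among them once the filter keeps something.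
filter-nonemptySublist :
  ∀ {B : Set b} {P : Pred B p} (P? : Decidable P) xs →
  filter P? xs ≡ [] ⊎ filter P? xs ∈ˡ nonemptySublists xs
filter-nonemptySublist P? []       = inj₁ refl
filter-nonemptySublist P? (x ∷ xs)
  with does (P? x) | filter-nonemptySublist P? xs
... | false | inj₁ eq = inj₁ eq
... | false | inj₂ ∈s = inj₂ (there (∈-++⁺ʳ _ ∈s))
... | true  | inj₁ eq = inj₂ (here (cong (x ∷_) eq))
... | true  | inj₂ ∈s = inj₂ (there (∈-++⁺ˡ (∈-map⁺ (x ∷_) ∈s)))

∈-support : (γ : GoalAssignment AP n) → ∀ {C} → C ∈supp γ → C ∈ˡ support γ
∈-support γ {C} = ∈-filter⁺ (λ C → ¬? (trivial? (γ C))) (∈-coalitions C)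

allSupported : GoalAssignment AP n → Coalition n
allSupported γ = ⋃ (support γ)

⊆-allSupported : (γ : GoalAssignment AP n) → ∀ {C} →
                 C ∈supp γ → C ⊆ allSupported γ
⊆-allSupported γ C∈ = ⊆-⋃ (∈-support γ C∈)

-- The largest union of supported coalitions inside `A`. Restricting `γ` to it keeps the goal of
-- every supported coalition inside `A`.
supportedIn : GoalAssignment AP n → Coalition n → Coalition n
supportedIn γ A = ⋃ (filter (_⊆? A) (support γ))

supportedIn-⊆ : (γ : GoalAssignment AP n) (A : Coalition n) →
                supportedIn γ A ⊆ A
supportedIn-⊆ γ A = ⋃-⊆ (All.all-filter (_⊆? A) (support γ))

module _ (γ : GoalAssignment AP n) {A D : Coalition n}
         (D∈ : D ∈supp γ) (D⊆A : D ⊆ A) where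

  private
    D∈filter : D ∈ˡ filter (_⊆? A) (support γ)
    D∈filter = ∈-filter⁺ (_⊆? A) (∈-support γ D∈) D⊆A

  ⊆-supportedIn : D ⊆ supportedIn γ A
  ⊆-supportedIn = ⊆-⋃ D∈filter

  supportedIn-∈unions : supportedIn γ A ∈ˡ unions γ
  supportedIn-∈unions with filter-nonemptySublist (_⊆? A) (support γ)
  ... | inj₁ eq = contradiction (subst (D ∈ˡ_) eq D∈filter) λ ()
  ... | inj₂ ∈s = ∈-map⁺ ⋃ ∈s

module _ {a ℓ : Level} {AP : Set a} {n : ℕ}
         (M : ConcurrentGameModel n AP ℓ) where

  open ConcurrentGameModel M
  open Semantics M

  -- Plays and strategies, split after the first round.

  AgreeAt : ∀ {w} → Coalition n → Profile w → Profile w → Set ℓ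
  AgreeAt C ζ ζ′ = ∀ i → i ∈ C → ζ′ i ≡ ζ i

  AgreeAt-⊆ : ∀ {w C D} {ζ ζ′ : Profile w} → D ⊆ C →
              AgreeAt C ζ ζ′ → AgreeAt D ζ ζ′
  AgreeAt-⊆ D⊆C agree i = agree i ∘ D⊆C

  prepend : ∀ {s} → Profile s → ∀ {v} → History v → History v
  prepend ζ (start w)   = start _ ▸ ζ ▸ w
  prepend ζ (h ▸ ξ ▸ w) = prepend ζ h ▸ ξ ▸ w

  -- Histories grow at the end, but a profile that reacts to the first round has to read them from
  -- the front; this view provides that reading.
  data FirstStep : ∀ {v} → History v → Set ℓ where
    none : ∀ {v} → FirstStep (start v)
    step : ∀ {s v} (ζ : Profile s) (h : History v) → FirstStep (prepend ζ h)

  firstStep : ∀ {v} (h : History v) → FirstStep h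
  firstStep (start v) = none
  firstStep (h ▸ ξ ▸ w) with firstStep h
  ... | none      = step ξ (start w)
  ... | step ζ h′ = step ζ (h′ ▸ ξ ▸ w)

  firstStep-prepend : ∀ {s} (ζ : Profile s) {v} (h : History v) →
                      firstStep (prepend ζ h) ≡ step ζ h
  firstStep-prepend ζ (start w)   = refl
  firstStep-prepend ζ (h ▸ ξ ▸ w) rewrite firstStep-prepend ζ h = refl

  tail : ∀ {s} → StrategyProfile → Profile s → StrategyProfile
  tail σ ζ i h = σ i (prepend ζ h)

  module _ (first : ∀ w → Profile w)
           (next : ∀ {s} → Profile s → StrategyProfile) where

    private
      act-on : ∀ {v} {h : History v} → FirstStep h → Profile v
      act-on (none {v}) = first v
      act-on (step ζ h) = choice (next ζ) h

    -- `first` covers every initial state and `next` every first round, because agreement of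
    -- profiles is demanded on all histories, reachable or not.
    _then_ : StrategyProfile
    _then_ i h = act-on (firstStep h) i

    tail-then : ∀ {s} (ζ : Profile s) {v} (h : History v) →
                choice (tail _then_ ζ) h ≡ choice (next ζ) h
    tail-then ζ h = cong act-on (firstStep-prepend ζ h)

    then-agree : ∀ {C σ} →
      (∀ w → AgreeAt C (choice σ (start w)) (first w)) →
      (∀ {s} (ζ : Profile s) → AgreeOn C (tail σ ζ) (next ζ)) →
      AgreeOn C σ _then_
    then-agree p q i i∈C h with firstStep h
    ... | none      = p _ i i∈C
    ... | step ζ h′ = q ζ i i∈C h′

  extend : StrategyProfile → ∃ History → ∃ History
  extend σ (v , h) = let v′ = out v (choice σ h) in v′ , (h ▸ choice σ h ▸ v′)

  module _ (s : State) (σ : StrategyProfile) where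

    private
      ζ  = choice σ (start s)
      s′ = out s ζ

    -- Both plays grow at the end, so prepending the first round commutes with adding one more
    -- round.
    play-suc : ∀ k → let (v , h) = play s′ (tail σ ζ) k in
               play s σ (suc k) ≡ (v , prepend ζ h)
    play-suc zero    = refl
    play-suc (suc k) = cong (extend σ) (play-suc k)

    path-suc : ∀ k → path s σ (suc k) ≡ path s′ (tail σ ζ) k
    path-suc k = cong proj₁ (play-suc k)

  play-cong : ∀ {s σ τ} → (∀ {v} (h : History v) → choice σ h ≡ choice τ h) →
              ∀ k → play s σ k ≡ play s τ k
  play-cong eq zero = refl
  play-cong {s} {σ} {τ} eq (suc k) = trans
    (cong (extend σ) (play-cong eq k))
    (cong (λ ξ → out v ξ , (h ▸ ξ ▸ out v ξ)) (eq h))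
    where
    v = proj₁ (play s τ k)
    h = proj₂ (play s τ k)

  -- Truth of goal assignments.

  trivialProfile : StrategyProfile
  trivialProfile i {w} h =
    let (x , x∈) = GameForm.act-nonempty (gameForm w) i in x , [ x∈ ]ⁱ

  -- The clause for `⟪ γ ⟫` read on the induced paths themselves, without the sequences pointwise
  -- equal to them.
  Enforces : Assignment → State → StrategyProfile → GoalAssignment AP n → Set ℓ
  Enforces ρ s σ γ =
    ∀ C σ′ → AgreeOn C σ σ′ → ρ , path s σ′ ⊩ γ C

  ⊩-resp : ∀ {ρ π π′} θ → (∀ k → π k ≡ π′ k) → ρ , π′ ⊩ θ → ρ , π ⊩ θ
  ⊩-resp {ρ} (X φ)   eq p = subst (λ w → ρ , w ⊨ φ) (sym (eq 1)) p
  ⊩-resp {ρ} (G φ)   eq p i = subst (λ w → ρ , w ⊨ φ) (sym (eq i)) (p i)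
  ⊩-resp {ρ} (φ U ψ) eq (i , p , q) =
    i , subst (λ w → ρ , w ⊨ ψ) (sym (eq i)) p
      , λ j j<i → subst (λ w → ρ , w ⊨ φ) (sym (eq j)) (q j j<i)

  ⟪⟫⁺ : ∀ {ρ s} γ → (∃ λ σ → Enforces ρ s σ γ) → ρ , s ⊨ ⟪ γ ⟫
  ⟪⟫⁺ γ (σ , enf) = σ , λ C π (σ′ , agree , eq) → ⊩-resp (γ C) eq (enf C σ′ agree)

  ⟪⟫⁻ : ∀ {ρ s} γ → ρ , s ⊨ ⟪ γ ⟫ → ∃ λ σ → Enforces ρ s σ γ
  ⟪⟫⁻ γ (σ , p) = σ , λ C σ′ agree → p C (path _ σ′) (σ′ , agree , λ _ → refl)

  ⟪⟫-mono : ∀ {ρ ρ′ s} γ γ′ → (∀ C π → ρ , π ⊩ γ C → ρ′ , π ⊩ γ′ C) →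
            ρ , s ⊨ ⟪ γ ⟫ → ρ′ , s ⊨ ⟪ γ′ ⟫
  ⟪⟫-mono γ γ′ f (σ , p) = σ , λ C π π∈ → f C π (p C π π∈)

  mutual
    -- `Trivial` sees through the identification of empty support with `⊤′`, so the recursion passes
    -- through `⟪_⟫`, where any profile is a witness.
    ⊩-trivial : ∀ {ρ π} θ → Trivial θ → ρ , π ⊩ θ
    ⊩-trivial (X φ) t = ⊨-top φ t

    ⊨-top : ∀ {ρ s} φ → IsTop φ → ρ , s ⊨ φ
    ⊨-top ⊤′    t = lift tt
    ⊨-top ⟪ γ ⟫ t = trivialProfile , λ C π _ → ⊩-trivial (γ C) (t C)

  ⊩-supported : ∀ {ρ π} (γ : GoalAssignment AP n) C →
                (C ∈supp γ → ρ , π ⊩ γ C) → ρ , π ⊩ γ C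
  ⊩-supported γ C f with trivial? (γ C)
  ... | yes t = ⊩-trivial (γ C) t
  ... | no ¬t = f ¬t

  module _ {P : Set p} {ρ : Assignment} {π : ℕ → State}
           {θ θ′ : PathFormula AP n} where

    ⊩-if⁺ : (d : Dec P) → (P → ρ , π ⊩ θ) → (¬ P → ρ , π ⊩ θ′) →
            ρ , π ⊩ (if does d then θ else θ′)
    ⊩-if⁺ (yes p) f g = f p
    ⊩-if⁺ (no ¬p) f g = g ¬p

    ⊩-if⁻ʸ : (d : Dec P) → P → ρ , π ⊩ (if does d then θ else θ′) → ρ , π ⊩ θ
    ⊩-if⁻ʸ d p = subst (λ b → ρ , π ⊩ (if b then θ else θ′)) (dec-true d p)

  ⟪⟫-restrict : ∀ {ρ s} γ C → ρ , s ⊨ ⟪ γ ⟫ → ρ , s ⊨ ⟪ γ ∣ C ⟫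
  ⟪⟫-restrict γ C = ⟪⟫-mono γ (γ ∣ C)
    (λ D π p → ⊩-if⁺ (D ⊆? C) (λ _ → p) (λ _ → lift tt))

  ⟪⟫-∖ : ∀ {ρ s} γ C → ρ , s ⊨ ⟪ γ ⟫ → ρ , s ⊨ ⟪ γ ∖ C ⟫
  ⟪⟫-∖ γ C = ⟪⟫-mono γ (γ ∖ C)
    (λ D π p → ⊩-if⁺ (D ≟ᶜ C) (λ _ → lift tt) (λ _ → p))

  -- Local unfolding of goals and of `ind`.

  ⋀⁺ : ∀ {ρ s φs} → All (ρ , s ⊨_) φs → ρ , s ⊨ ⋀ φs
  ⋀⁺ []           = lift tt
  ⋀⁺ (p ∷ [])     = p
  ⋀⁺ (p ∷ q ∷ ps) = p , ⋀⁺ (q ∷ ps)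

  ⋀⁻ : ∀ {ρ s} φs → ρ , s ⊨ ⋀ φs → All (ρ , s ⊨_) φs
  ⋀⁻ []           _        = []
  ⋀⁻ (φ ∷ [])     p        = p ∷ []
  ⋀⁻ (φ ∷ ψ ∷ φs) (p , ps) = p ∷ ⋀⁻ (ψ ∷ φs) ps

  ⋁⁺ : ∀ {ρ s φs} → Any (ρ , s ⊨_) φs → ρ , s ⊨ ⋁ φs
  ⋁⁺ {φs = _ ∷ []}    (here p)  = p
  ⋁⁺ {φs = _ ∷ _ ∷ _} (here p)  = inj₁ p
  ⋁⁺ {φs = _ ∷ _ ∷ _} (there p) = inj₂ (⋁⁺ p)

  ⋁⁻ : ∀ {ρ s} φs → ρ , s ⊨ ⋁ φs → Any (ρ , s ⊨_) φs
  ⋁⁻ []           p        = contradiction (lift tt) p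
  ⋁⁻ (φ ∷ [])     p        = here p
  ⋁⁻ (φ ∷ ψ ∷ φs) (inj₁ p) = here p
  ⋁⁻ (φ ∷ ψ ∷ φs) (inj₂ p) = there (⋁⁻ (ψ ∷ φs) p)

  -- The local conditions in U ≡ β ∨ (α ∧ X U) and G ≡ χ ∧ X G.
  Finishes Continues : Assignment → State → PathFormula AP n → Set ℓ
  Finishes ρ s (α U β) = ρ , s ⊨ β
  Finishes ρ s (X _)   = Lift ℓ ⊥
  Finishes ρ s (G _)   = Lift ℓ ⊥
  Continues ρ s (α U β) = ρ , s ⊨ α
  Continues ρ s (G χ)   = ρ , s ⊨ χ
  Continues ρ s (X _)   = Lift ℓ ⊥

  ⊩-finish : ∀ {ρ π} θ → Finishes ρ (π 0) θ → ρ , π ⊩ θ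
  ⊩-finish (α U β) p = 0 , p , λ _ ()

  ⊩-continue : ∀ {ρ π} θ → Continues ρ (π 0) θ → ρ , π ∘ suc ⊩ θ → ρ , π ⊩ θ
  ⊩-continue (α U β) p (i , q , r) =
    suc i , q , λ { zero _ → p ; (suc j) j<i → r j (s<s⁻¹ j<i) }
  ⊩-continue (G χ) p q zero    = p
  ⊩-continue (G χ) p q (suc i) = q i

  -- If a `U` goal is not finished at once, its witnessing index is a successor: `α` holds now and
  -- the goal survives the shift by one.
  ⊩-unfold : ∀ {ρ π} θ → IsU θ ⊎ IsG θ → ¬ Finishes ρ (π 0) θ → ρ , π ⊩ θ →
             Continues ρ (π 0) θ × (ρ , π ∘ suc ⊩ θ)
  ⊩-unfold (α U β) _ ¬fin (zero  , p , _) = contradiction p ¬fin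
  ⊩-unfold (α U β) _ ¬fin (suc i , p , q) =
    q 0 z<s , i , p , λ j j<i → q (suc j) (s<s j<i)
  ⊩-unfold (G χ) _ _ p = p 0 , p ∘ suc
  ⊩-unfold (X φ) (inj₁ (_ , _ , ()))
  ⊩-unfold (X φ) (inj₂ (_ , ()))

  module _ {ρ : Assignment} {s : State} (γ : GoalAssignment AP n) where

    private
      Sat : StateFormula AP n → Set ℓ
      Sat = ρ , s ⊨_

      finishOf⁻ : ∀ C θ → Any Sat (finishOf γ C θ) →
                  Finishes ρ s θ × (ρ , s ⊨ ⟪ γ ∖ C ⟫)
      finishOf⁻ C (α U β) (here p) = p

      finishOf⁺ : ∀ C θ → Finishes ρ s θ → ρ , s ⊨ ⟪ γ ∖ C ⟫ →
                  Any Sat (finishOf γ C θ)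
      finishOf⁺ C (α U β) p q = here (p , q)

      holds⁺ : ∀ θ → (¬ Trivial θ → Continues ρ s θ) →
               All Sat (uHoldsOf θ) × All Sat (gHoldsOf θ)
      holds⁺ (α U β) f = f (λ ()) ∷ [] , []
      holds⁺ (G χ)   f = [] , f (λ ()) ∷ []
      holds⁺ (X φ)   f = [] , []

      holds⁻ : ∀ θ → IsU θ ⊎ IsG θ →
               All Sat (uHoldsOf θ) → All Sat (gHoldsOf θ) → Continues ρ s θ
      holds⁻ (α U β) _ (p ∷ []) _        = p
      holds⁻ (G χ)   _ _        (p ∷ []) = p
      holds⁻ (X φ)   (inj₁ (_ , _ , ()))
      holds⁻ (X φ)   (inj₂ (_ , ()))

      module _ (f : Coalition n → List (StateFormula AP n)) where

        concatMap⁺ : (∀ C → All Sat (f C)) →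
                     All Sat (concatMap f (coalitions n))
        concatMap⁺ ps =
          All.concat⁺ (All.map⁺ (All.universal ps (coalitions n)))

        concatMap⁻ : All Sat (concatMap f (coalitions n)) →
                     ∀ C → All Sat (f C)
        concatMap⁻ ps C =
          All.lookup (All.map⁻ (All.concat⁻ ps)) (∈-coalitions C)

    ind-finish : ∀ {φ} C → Finishes ρ s (γ C) → ρ , s ⊨ ⟪ γ ∖ C ⟫ →
                 ρ , s ⊨ ind γ φ
    ind-finish C p q = ⋁⁺ (Any.++⁺ˡ (Any.concatMap⁺ (λ C → finishOf γ C (γ C))
      (lose (∈-coalitions C) (finishOf⁺ C (γ C) p q))))

    ind-continue : ∀ {φ} → (∀ C → C ∈supp γ → Continues ρ s (γ C)) →
                   ρ , s ⊨ ⟪ Δ γ ⟨ φ ⟩ ⟫ → ρ , s ⊨ ind γ φ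
    ind-continue f p = ⋁⁺ (Any.++⁺ʳ (Finish γ) (here (⋀⁺ (All.++⁺
      (concatMap⁺ (uHoldsOf ∘ γ) (λ C → proj₁ (holds⁺ (γ C) (f C))))
      (All.++⁺
        (concatMap⁺ (gHoldsOf ∘ γ) (λ C → proj₂ (holds⁺ (γ C) (f C))))
        (p ∷ []))))))

    -- Together with `ind-finish` and `ind-continue` this reduces `ind` to two cases, finish now or
    -- continue, free of list bookkeeping.
    ind⁻ : ∀ {φ} → ρ , s ⊨ ind γ φ →
           (∃ λ C → Finishes ρ s (γ C) × (ρ , s ⊨ ⟪ γ ∖ C ⟫)) ⊎
           ((∀ C → IsU (γ C) ⊎ IsG (γ C) → Continues ρ s (γ C)) ×
            (ρ , s ⊨ ⟪ Δ γ ⟨ φ ⟩ ⟫))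
    ind⁻ {φ} p with Any.++⁻ (Finish γ) (⋁⁻ (Finish γ ∷ʳ _) p)
    ... | inj₁ q =
      let (C , _ , r) = find (Any.concatMap⁻ _ {xs = coalitions n} q)
      in inj₁ (C , finishOf⁻ C (γ C) r)
    ... | inj₂ (here q) =
      let all       = ⋀⁻ (UHolds γ ++ GHolds γ ++ [ ⟪ Δ γ ⟨ φ ⟩ ⟫ ]) q
          us , rest = All.++⁻ (UHolds γ) all
          gs , ds   = All.++⁻ (GHolds γ) rest
      in inj₂ ((λ C lt → holds⁻ (γ C) lt (concatMap⁻ (uHoldsOf ∘ γ) us C)
                                         (concatMap⁻ (gHoldsOf ∘ γ) gs C))
              , All.head ds)

  -- Independence of a fresh variable.

  AgreeOff : Var → Assignment → Assignment → Set ℓ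
  AgreeOff z ρ ρ′ = ∀ y → z ≢ y → ρ y ≡ ρ′ y

  mutual
    -- Negation exchanges the two assignments, so their agreement is carried in both directions.
    ⊨-coincide : ∀ {z ρ ρ′ s} → AgreeOff z ρ ρ′ → AgreeOff z ρ′ ρ →
                 ∀ φ → IsTLCGA φ → Fresh z φ → ρ , s ⊨ φ → ρ′ , s ⊨ φ
    ⊨-coincide e e′ (atom q) _ _ p = p
    ⊨-coincide {s = s} e e′ (var y) _ z≢y p =
      subst (λ Z → Lift ℓ (T (Z s))) (e y z≢y) p
    ⊨-coincide e e′ ⊤′ _ _ p = p
    ⊨-coincide e e′ (¬′ φ) t f p = p ∘ ⊨-coincide e′ e φ t f
    ⊨-coincide e e′ (φ ∧′ ψ) (t , t′) (f , f′) (p , q) =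
      ⊨-coincide e e′ φ t f p , ⊨-coincide e e′ ψ t′ f′ q
    ⊨-coincide e e′ (φ ∨′ ψ) (t , t′) (f , f′) =
      Sum.map (⊨-coincide e e′ φ t f) (⊨-coincide e e′ ψ t′ f′)
    ⊨-coincide e e′ ⟪ γ ⟫ t f (σ , p) =
      σ , λ C π π∈ → ⊩-coincide e e′ (γ C) (t C) (f C) (p C π π∈)

    ⊩-coincide : ∀ {z ρ ρ′ π} → AgreeOff z ρ ρ′ → AgreeOff z ρ′ ρ →
                 ∀ θ → IsTLCGAᵖ θ → Freshᵖ z θ → ρ , π ⊩ θ → ρ′ , π ⊩ θ
    ⊩-coincide e e′ (X φ) t f p = ⊨-coincide e e′ φ t f p
    ⊩-coincide e e′ (G φ) t f p i = ⊨-coincide e e′ φ t f (p i)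
    ⊩-coincide e e′ (φ U ψ) (t , t′) (f , f′) (i , p , q) =
      i , ⊨-coincide e e′ ψ t′ f′ p
        , λ j j<i → ⊨-coincide e e′ φ t f (q j j<i)

  ↦-agreeOff : ∀ ρ z Z → AgreeOff z (ρ [ z ↦ Z ]) ρ
  ↦-agreeOff ρ z Z y z≢y rewrite dec-false (y ≟ⁿ z) (z≢y ∘ sym) = refl

  ↦-same : ∀ ρ z Z → (ρ [ z ↦ Z ]) z ≡ Z
  ↦-same ρ z Z rewrite dec-true (z ≟ⁿ z) refl = refl

  module _ (em : ExcludedMiddle ℓ) where

    -- One-round deviations from a profile.

    module _ (s : State) (σ : StrategyProfile) (ζ : Profile s)
             (τ : StrategyProfile) where

      private
        first : ∀ w → Profile w
        first w with em {w ≡ s}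
        ... | yes refl = ζ
        ... | no _     = choice σ (start w)

        next : ∀ {w} → Profile w → StrategyProfile
        next {w} ξ with em {_≡_ {A = ∃ Profile} (w , ξ) (s , ζ)}
        ... | yes _ = τ
        ... | no _  = tail σ ξ

        first-s : first s ≡ ζ
        first-s with em {s ≡ s}
        ... | yes refl = refl
        ... | no s≢s   = contradiction refl s≢s

        -- Stated up to `ξ ≡ ζ` because `first s` equals `ζ` only propositionally.
        next-ζ : ∀ {ξ : Profile s} → ξ ≡ ζ → ∀ {v} (h : History v) →
                 choice (next ξ) h ≡ choice τ h
        next-ζ refl h with em {_≡_ {A = ∃ Profile} (s , ζ) (s , ζ)}
        ... | yes _ = refl
        ... | no ≢  = contradiction refl ≢

      -- Departs from `σ` only at `start s`, where it plays `ζ`, and after that round, where it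
      -- plays `τ`. A play of `τ` from `out s ζ` thus becomes the rest of a play from `s`, and
      -- agreement with `σ` can fail nowhere else.
      deviate : StrategyProfile
      deviate = first then next

      path-deviate : ∀ k → path s deviate (suc k) ≡ path (out s ζ) τ k
      path-deviate k = trans (path-suc s deviate k) (trans
        (cong proj₁ (play-cong
          (λ h → trans (tail-then first next (first s) h) (next-ζ first-s h)) k))
        (cong (λ ξ → path (out s ξ) τ k) first-s))

      deviate-agree : ∀ {C} → AgreeAt C (choice σ (start s)) ζ →
                      AgreeOn C (tail σ ζ) τ → AgreeOn C σ deviate
      deviate-agree {C} ζ-agree τ-agree =
        then-agree first next first-agree next-agree
        where
        first-agree : ∀ w → AgreeAt C (choice σ (start w)) (first w)
        first-agree w with em {w ≡ s}
        ... | yes refl = ζ-agree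
        ... | no _     = λ _ _ → refl

        next-agree : ∀ {w} (ξ : Profile w) → AgreeOn C (tail σ ξ) (next ξ)
        next-agree {w} ξ with em {_≡_ {A = ∃ Profile} (w , ξ) (s , ζ)}
        ... | yes refl = τ-agree
        ... | no _     = λ _ _ _ → refl

    module _ {w} (ζ ζ′ : Profile w) where

      followers : Coalition n
      followers = tabulate (λ i → does (em {ζ′ i ≡ ζ i}))

      followers-agree : AgreeAt followers ζ ζ′
      followers-agree i i∈ with em {ζ′ i ≡ ζ i} | trans
        (sym (lookup∘tabulate (λ i → does (em {ζ′ i ≡ ζ i})) i)) ([]=⇒lookup i∈)
      ... | yes eq | _ = eq

      ⊆-followers : ∀ {D} → AgreeAt D ζ ζ′ → D ⊆ followers
      ⊆-followers agree {i} i∈ = lookup⇒[]= i _ (trans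
        (lookup∘tabulate (λ i → does (em {ζ′ i ≡ ζ i})) i)
        (dec-true em (agree i i∈)))

    module _ {ρ : Assignment} (γ : GoalAssignment AP n)
             (longTerm : LongTermTemporal γ) (φ : StateFormula AP n) where

      open DecMembership (_≟ᶜ_ {n}) using (_∈?_)

      -- The extension of `⟪ γ ⟫` is a pre-fixpoint.

      module _ (φ⇒γ : ∀ t → ρ , t ⊨ φ → ρ , t ⊨ ⟪ γ ⟫) where

        -- At the union of the whole support the goal is `X φ`, and `φ` yields `⟪ γ ⟫`, which is
        -- then restricted; at other unions `Δ γ` says it directly.
        Δ⇒⟪∣⟫ : ∀ {π C} → C ∈ˡ unions γ → ρ , π ⊩ Δ γ ⟨ φ ⟩ C →
                ρ , π 1 ⊨ ⟪ γ ∣ C ⟫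
        Δ⇒⟪∣⟫ {π} {C} C∈ p with C ≟ᶜ allSupported γ
        ... | yes _ = ⟪⟫-restrict γ C (φ⇒γ _ p)
        ... | no _  = ⊩-if⁻ʸ {ρ = ρ} {π} {X ⟪ γ ∣ C ⟫} (C ∈? unions γ) C∈ p

        -- One profile must serve all coalitions at once. A supported coalition that kept to the
        -- first round lies inside `loyal ζ`, so a single witness of `⟪ γ ∣ loyal ζ ⟫` serves all of
        -- them afterwards.
        continue : ∀ {s} →
          (∀ C → IsU (γ C) ⊎ IsG (γ C) → Continues ρ s (γ C)) →
          ρ , s ⊨ ⟪ Δ γ ⟨ φ ⟩ ⟫ → ρ , s ⊨ ⟪ γ ⟫
        continue {s} now later = ⟪⟫⁺ γ (τ , enforced)
          where
          σ     = proj₁ (⟪⟫⁻ (Δ γ ⟨ φ ⟩) later)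
          σ-enf = proj₂ (⟪⟫⁻ (Δ γ ⟨ φ ⟩) later)

          first : ∀ w → Profile w
          first w = choice σ (start w)

          loyal : ∀ {w} → Profile w → Coalition n
          loyal {w} ζ = supportedIn γ (followers (first w) ζ)

          next : ∀ {w} → Profile w → StrategyProfile
          next {w} ζ with em {ρ , out w ζ ⊨ ⟪ γ ∣ loyal ζ ⟫}
          ... | yes (τ , _) = τ
          -- An arbitrary default: by `after` it is never met following a round from `s` in which
          -- some supported coalition kept to `τ`.
          ... | no _        = σ

          next-enforces : ∀ {w} (ζ : Profile w) →
            ρ , out w ζ ⊨ ⟪ γ ∣ loyal ζ ⟫ →
            Enforces ρ (out w ζ) (next ζ) (γ ∣ loyal ζ)
          next-enforces {w} ζ p with em {ρ , out w ζ ⊨ ⟪ γ ∣ loyal ζ ⟫}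
          ... | yes q = proj₂ (⟪⟫⁻ (γ ∣ loyal ζ) q)
          ... | no ¬p = contradiction p ¬p

          τ : StrategyProfile
          τ = first then next

          module _ (D : Coalition n) (τ′ : StrategyProfile)
                   (agree : AgreeOn D τ τ′) (D∈ : D ∈supp γ) where

            ζ : Profile s
            ζ = choice τ′ (start s)

            A C : Coalition n
            A = followers (first s) ζ
            C = loyal ζ

            D⊆A : D ⊆ A
            D⊆A = ⊆-followers (first s) ζ (λ i i∈D → agree i i∈D (start s))

            -- `τ′` shares with `σ` only its first moves, whereas `σ-enf` needs agreement on all
            -- histories. This profile makes the same first round `ζ` and otherwise follows `σ`.
            σ⁺ : StrategyProfile
            σ⁺ = deviate s σ ζ (tail σ ζ)

            σ⁺-agree : AgreeOn C σ σ⁺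
            σ⁺-agree = deviate-agree s σ ζ (tail σ ζ)
              (AgreeAt-⊆ (supportedIn-⊆ γ A) (followers-agree (first s) ζ))
              (λ _ _ _ → refl)

            after : ρ , out s ζ ⊨ ⟪ γ ∣ C ⟫
            after = subst (λ t → ρ , t ⊨ ⟪ γ ∣ C ⟫)
              (path-deviate s σ ζ (tail σ ζ) 0)
              (Δ⇒⟪∣⟫ (supportedIn-∈unions γ D∈ D⊆A) (σ-enf C σ⁺ σ⁺-agree))

            tail-agree : AgreeOn D (next ζ) (tail τ′ ζ)
            tail-agree i i∈D h = trans (agree i i∈D (prepend ζ h))
              (cong (λ ξ → ξ i) (tail-then first next ζ h))

            tail-goal : ρ , path (out s ζ) (tail τ′ ζ) ⊩ γ D
            tail-goal = ⊩-if⁻ʸ (D ⊆? C) (⊆-supportedIn γ D∈ D⊆A)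
              (next-enforces ζ after D (tail τ′ ζ) tail-agree)

            goal : ρ , path s τ′ ⊩ γ D
            goal = ⊩-continue (γ D) (now D (longTerm D D∈))
              (⊩-resp (γ D) (path-suc s τ′) tail-goal)

          enforced : Enforces ρ s τ γ
          enforced D τ′ agree = ⊩-supported γ D (goal D τ′ agree)

        -- The goal dropped at `C` is met at time 0 on every path from `s`, so a witness for the
        -- remaining goals serves unchanged.
        finish : ∀ {s} C → Finishes ρ s (γ C) → ρ , s ⊨ ⟪ γ ∖ C ⟫ →
                 ρ , s ⊨ ⟪ γ ⟫
        finish C fin p =
          let σ , enf = ⟪⟫⁻ (γ ∖ C) p in ⟪⟫⁺ γ (σ , enforced σ enf)
          where
          enforced : ∀ σ → Enforces ρ _ σ (γ ∖ C) → Enforces ρ _ σ γ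
          enforced σ enf D σ′ agree with D ≟ᶜ C | enf D σ′ agree
          ... | yes refl | _ = ⊩-finish (γ C) fin
          ... | no _     | q = q

        ind⇒⟪⟫ : ∀ {s} → ρ , s ⊨ ind γ φ → ρ , s ⊨ ⟪ γ ⟫
        ind⇒⟪⟫ p with ind⁻ γ p
        ... | inj₁ (C , fin , q)  = finish C fin q
        ... | inj₂ (now , later) = continue now later

      -- The extension lies below every pre-fixpoint.

      module _ (typeU : OfTypeU γ)
               (ind⇒φ : ∀ t → ρ , t ⊨ ind γ φ → ρ , t ⊨ φ) where

        private
          V : Coalition n
          V = allSupported γ

        module _ {s} (¬φ : ¬ (ρ , s ⊨ φ)) where

          unfinished : ρ , s ⊨ ⟪ γ ⟫ → ∀ C → ¬ Finishes ρ s (γ C)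
          unfinished p C fin = ¬φ (ind⇒φ s (ind-finish γ C fin (⟪⟫-∖ γ C p)))

          module _ (σ : StrategyProfile) (enf : Enforces ρ s σ γ) where

            private
              unfold : ∀ C → C ∈supp γ → ∀ σ′ → AgreeOn C σ σ′ →
                       Continues ρ s (γ C) × (ρ , path s σ′ ∘ suc ⊩ γ C)
              unfold C C∈ σ′ agree = ⊩-unfold (γ C) (longTerm C C∈)
                (unfinished (⟪⟫⁺ γ (σ , enf)) C) (enf C σ′ agree)

            -- `deviate` turns `τ` into a profile from `s` agreeing with `σ` on `D`. Its goal is
            -- unfinished at `s`, so it passes to the shifted path.
            tail-enforces : ∀ {C} ζ → AgreeAt C (choice σ (start s)) ζ →
              ∀ D → D ∈supp γ → D ⊆ C → ∀ τ → AgreeOn D (tail σ ζ) τ →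
              ρ , path (out s ζ) τ ⊩ γ D
            tail-enforces ζ ζ-agree D D∈ D⊆C τ τ-agree = ⊩-resp (γ D)
              (λ k → sym (path-deviate s σ ζ τ k))
              (proj₂ (unfold D D∈ (deviate s σ ζ τ)
                (deviate-agree s σ ζ τ (AgreeAt-⊆ D⊆C ζ-agree) τ-agree)))

            Escape : Set ℓ
            Escape = Σ[ ζ ∈ Profile s ]
              AgreeAt V (choice σ (start s)) ζ × ¬ (ρ , out s ζ ⊨ φ)

            -- Otherwise `σ` itself would witness `⟪ Δ γ ⟨ φ ⟩ ⟫`: every first round kept by `V`
            -- leads to `φ`, and at the other unions `tail σ ζ` witnesses the restricted assignment.
            -- Then `ind γ φ`, hence `φ`, would hold at `s`.
            escape : Escape
            escape = decidable-stable em λ ¬escape →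
              ¬φ (ind⇒φ s (ind-continue γ
                (λ C C∈ → proj₁ (unfold C C∈ σ (λ _ _ _ → refl)))
                (⟪⟫⁺ (Δ γ ⟨ φ ⟩) (σ , λ C σ′ agree →
                  let ζ       = choice σ′ (start s)
                      ζ-agree = λ i i∈C → agree i i∈C (start s)
                  in ⊩-if⁺ {θ = X φ} (C ≟ᶜ V)
                    (λ { refl → decidable-stable em λ ¬φ′ →
                         ¬escape (ζ , ζ-agree , ¬φ′) })
                    (λ _ → ⊩-if⁺ {θ = X ⟪ γ ∣ C ⟫} (C ∈? unions γ)
                      (λ _ → ⟪⟫⁺ (γ ∣ C) (tail σ ζ , λ D τ agree′ →
                        ⊩-if⁺ (D ⊆? C)
                          (λ D⊆C → ⊩-supported γ D λ D∈ →
                            tail-enforces ζ ζ-agree D D∈ D⊆C τ agree′)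
                          (λ _ → lift tt)))
                      (λ _ → lift tt))))))

        -- The correction depends only on the current round, not on the history, so
        -- `tail (avoiding σ) ζ` is `avoiding (tail σ ζ)` by computation.
        avoid : ∀ {w} → Profile w → Profile w
        avoid {w} ξ
          with em {Σ[ ζ ∈ Profile w ] AgreeAt V ξ ζ × ¬ (ρ , out w ζ ⊨ φ)}
        ... | yes (ζ , _) = ζ
        ... | no _        = ξ

        avoid-agree : ∀ {w} (ξ : Profile w) → AgreeAt V ξ (avoid ξ)
        avoid-agree {w} ξ
          with em {Σ[ ζ ∈ Profile w ] AgreeAt V ξ ζ × ¬ (ρ , out w ζ ⊨ φ)}
        ... | yes (_ , agree , _) = agree
        ... | no _                = λ _ _ → refl

        avoid-¬φ : ∀ {s} (¬φ : ¬ (ρ , s ⊨ φ)) σ (enf : Enforces ρ s σ γ) →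
                   ¬ (ρ , out s (avoid (choice σ (start s))) ⊨ φ)
        -- `Escape` unfolds to the type that `avoid` decides, so this `with` also evaluates `avoid`.
        avoid-¬φ {s} ¬φ σ enf with em {Escape ¬φ σ enf}
        ... | yes (_ , _ , ¬φ′) = ¬φ′
        ... | no ¬esc           = contradiction (escape ¬φ σ enf) ¬esc

        avoiding : StrategyProfile → StrategyProfile
        avoiding σ i h = avoid (choice σ h) i

        -- The induction moves the initial state: after one corrected round `ζ`, kept by all of `V`,
        -- the residual `tail σ ζ` enforces all of `γ` again.
        avoiding-invariant : ∀ k {s} → ¬ (ρ , s ⊨ φ) →
          ∀ σ → Enforces ρ s σ γ →
          let t = path s (avoiding σ) k in
          ¬ (ρ , t ⊨ φ) × (ρ , t ⊨ ⟪ γ ⟫)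
        avoiding-invariant zero ¬φ σ enf = ¬φ , ⟪⟫⁺ γ (σ , enf)
        avoiding-invariant (suc k) {s} ¬φ σ enf = subst
          (λ t → ¬ (ρ , t ⊨ φ) × (ρ , t ⊨ ⟪ γ ⟫))
          (sym (path-suc s (avoiding σ) k))
          (avoiding-invariant k (avoid-¬φ ¬φ σ enf) (tail σ ζ)
            (λ D τ agree → ⊩-supported γ D λ D∈ →
              tail-enforces ¬φ σ enf ζ (avoid-agree (choice σ (start s)))
                D D∈ (⊆-allSupported γ D∈) τ agree))
          where
          ζ : Profile s
          ζ = avoid (choice σ (start s))

        -- A `U` goal has to reach its `β` at some finite stage of the avoiding play, but the
        -- invariant makes every stage unfinished.
        ⟪⟫⇒φ : ∀ {s} → ρ , s ⊨ ⟪ γ ⟫ → ρ , s ⊨ φ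
        ⟪⟫⇒φ {s} p = decidable-stable em λ ¬φ →
          let σ , enf = ⟪⟫⁻ γ p
              C , α , β , γC≡ = typeU
              -- `Trivial` is empty at a `U` goal, so `C` is supported and lies inside `V`, where
              -- `avoiding σ` keeps to `σ`.
              C∈ = subst (λ θ → ¬ Trivial θ) (sym γC≡) id
              i , q , _ = subst (ρ , path s (avoiding σ) ⊩_) γC≡
                (enf C (avoiding σ) λ i i∈C h →
                  avoid-agree (choice σ h) i (⊆-allSupported γ C∈ i∈C))
              ¬φᵢ , pᵢ = avoiding-invariant i ¬φ σ enf
          in unfinished ¬φᵢ pᵢ C (subst (Finishes ρ _) (sym γC≡) q)

-- From pre-fixpoints to the formula with `μ`.

proposition6 : {a ℓ : Level} → ExcludedMiddle ℓ →
    {AP : Set a} {n : ℕ} (γ : GoalAssignment AP n) →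
    IsTLCGA ⟪ γ ⟫ → LongTermTemporal γ → OfTypeU γ →
    (z : Var) (fresh : Fresh z ⟪ γ ⟫) →
    Equivalent ℓ ⟪ γ ⟫ (μ z (ind γ (var z)) (ind-positive γ z fresh))
proposition6 {ℓ = ℓ} em {AP} {n} γ tlcga longTerm typeU z fresh M ρ s =
  -- The intersection of all pre-fixpoints is instantiated at `W`, the extension of `⟪ γ ⟫` under
  -- `ρ`.
  mk⇔ below-prefixpoints (λ p → toWitness (p W W-prefixpoint))
  where
  open ConcurrentGameModel M
  open Semantics M

  var⁺ : ∀ Z {t} → T (Z t) → (ρ [ z ↦ Z ]) , t ⊨ var z
  var⁺ Z {t} p = lift (subst (λ Y → T (Y t)) (sym (↦-same M ρ z Z)) p)

  var⁻ : ∀ Z {t} → (ρ [ z ↦ Z ]) , t ⊨ var z → T (Z t)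
  var⁻ Z {t} (lift p) = subst (λ Y → T (Y t)) (↦-same M ρ z Z) p

  module _ (Z : State → Bool) {t : State} where

    -- Both directions work under the changed assignment; as `z` is fresh, `⟪ γ ⟫` does not see the
    -- change.
    weaken : ρ , t ⊨ ⟪ γ ⟫ → (ρ [ z ↦ Z ]) , t ⊨ ⟪ γ ⟫
    weaken = ⊨-coincide M (λ y z≢y → sym (↦-agreeOff M ρ z Z y z≢y))
      (↦-agreeOff M ρ z Z) ⟪ γ ⟫ tlcga fresh

    strengthen : (ρ [ z ↦ Z ]) , t ⊨ ⟪ γ ⟫ → ρ , t ⊨ ⟪ γ ⟫
    strengthen = ⊨-coincide M (↦-agreeOff M ρ z Z)
      (λ y z≢y → sym (↦-agreeOff M ρ z Z y z≢y)) ⟪ γ ⟫ tlcga fresh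

  below-prefixpoints : ρ , s ⊨ ⟪ γ ⟫ → ∀ Z →
    (∀ t → (ρ [ z ↦ Z ]) , t ⊨ ind γ (var z) → T (Z t)) → T (Z s)
  below-prefixpoints p Z pre = var⁻ Z
    (⟪⟫⇒φ M em γ longTerm (var z) typeU (λ t → var⁺ Z ∘ pre t) (weaken Z p))

  W : State → Bool
  W t = ⌊ em {ρ , t ⊨ ⟪ γ ⟫} ⌋

  W-prefixpoint : ∀ t → (ρ [ z ↦ W ]) , t ⊨ ind γ (var z) → T (W t)
  W-prefixpoint t p = fromWitness (strengthen W
    (ind⇒⟪⟫ M em γ longTerm (var z)
      (λ t′ q → weaken W (toWitness (var⁻ W q))) p))
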